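{- Let $\tau$ be a valid sequence of instructions over $\Sigma^{\mathsf{DS}}_{\mathsf{Clocks}}$. Then the weighted graph $\mathcal{G}_\tau$ can be $\mathsf{CPDL}$-interpreted in the $(\Sigma^{\mathsf{DS}}_{\mathsf{Clocks}},\Gamma^{\mathsf{DS}})$-graph $G_\tau$.
   Context: Labeled graphs. A $(\Sigma,\Gamma)$-labeled graph is $G=(V,E,\lambda)$ with $V$ finite, $\lambda:V\to 2^{\Sigma}$, $E\subseteq V\times\Gamma\times V$; $E_\gamma=\{(u,v):(u,\gamma,v)\in E\}$; $\mathsf{succ}\in\Gamma$. Logic. In $\mathsf{CPDL}(\Sigma,\Gamma)$, state formulae $\sigma$ and path formulae $\pi$ are (for $p\in\Sigma$, $\gamma\in\Gamma$): $\sigma::=\top\mid p\mid\sigma\vee\sigma\mid\neg\sigma\mid\langle\pi\rangle\sigma$ and $\pi::=\xrightarrow{\gamma}\mid\mathsf{test}\{\sigma\}\mid\pi+\pi\mid\pi\cdot\pi\mid\pi^*\mid\pi^{ -1}$. State formulae denote subsets of $V$, path formulae binary relations on $V$: $[\![p]\!]=\{v:p\in\lambda(v)\}$, $[\![\top]\!]=V$, Booleans as usual, $[\![\langle\pi\rangle\sigma]\!]=\{u:\exists v\in[\![\sigma]\!],(u,v)\in[\![\pi]\!]\}$, $[\![\xrightarrow{\gamma}]\!]=E_\gamma$, $[\![\mathsf{test}\{\sigma\}]\!]=\{(v,v):v\in[\![\sigma]\!]\}$, and $+,\cdot,{}^*,{}^{ -1}$ are union, composition, reflexive-transitive closure, converse.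 $G,u\models\sigma$ means $u\in[\![\sigma]\!]$ and $G,u,v\models\pi$ means $(u,v)\in[\![\pi]\!]$. Interpretations. A $\mathsf{CPDL}$ interpretation $\mathcal{I}$ (of $(\Sigma',\Gamma')$-graphs in $(\Sigma,\Gamma)$-graphs on the same vertex set) is given by state formulae $(\sigma_p)_{p\in\Sigma'}$ and path formulae $(\pi_\gamma)_{\gamma\in\Gamma'}$, all in $\mathsf{CPDL}(\Sigma,\Gamma)$. A $(\Sigma',\Gamma')$-graph $G'=(V,E',\lambda')$ is $\mathcal{I}$-interpreted in the $(\Sigma,\Gamma)$-graph $G=(V,E,\lambda)$, written $G'=\mathcal{I}(G)$, if for all $u,v\in V$, $p\in\Sigma'$, $\gamma\in\Gamma'$: $p\in\lambda'(u)$ iff $G,u\models\sigma_p$, and $(u,\gamma,v)\in E'$ iff $G,u,v\models\pi_\gamma$. $G'$ can be $\mathsf{CPDL}$-interpreted in $G$ if $G'=\mathcal{I}(G)$ for some $\mathsf{CPDL}$ interpretation $\mathcal{I}$. Instructions. $\mathsf{DS}$ is a finite set of data structures, each designated a stack or a queue; $\Sigma^{\mathsf{DS}}=\{r(d),w(d):d\in\mathsf{DS}\}\cup\{\mathrm{nop}\}$ and $\Gamma^{\mathsf{DS}}=\mathsf{DS}\cup\{\mathsf{succ}\}$. A sequence $\sigma$ over $\Sigma^{\mathsf{DS}}$ is valid if for every $d$ each prefix has at most as many $r(d)$ as $w(d)$, and $\sigma$ has equally many of both. For valid $\sigma=\sigma_1\cdots\sigma_n$, $G_\sigma$ has $V=\{1,\dots,n\}$,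 $\lambda(i)=\{\sigma_i\}$, $\mathsf{succ}$-edges $i\to i+1$, and for each $d$ the $d$-edges matching each write position $w(d)$ to exactly one later read position $r(d)$ (bijectively), LIFO (well-nested) if $d$ is a stack and FIFO if $d$ is a queue. Let $\mathsf{Clocks}$ be a finite set of clocks and $M\ge1$. $\Sigma^{\mathsf{DS}}_{\mathsf{Clocks}}$ consists of $\Sigma^{\mathsf{DS}}$, resets $x:=0$, and constraints $x\bowtie\beta$, $d\bowtie\beta$, $(x-y)\bowtie\beta$, $(d-x)\bowtie\beta$, $(x-d)\bowtie\beta$ for $x,y\in\mathsf{Clocks}$, $d\in\mathsf{DS}$, ${\bowtie}\in\{\le,<,=,>,\ge\}$, $\beta\in\{0,\dots,M-1\}$. A sequence of instructions is $\tau=\tau_1\cdots\tau_n$ with each $\tau_i\subseteq\Sigma^{\mathsf{DS}}_{\mathsf{Clocks}}$ containing exactly one element of $\Sigma^{\mathsf{DS}}$, and $\tau_1=\{\mathrm{nop}\}\cup\{x:=0:x\in\mathsf{Clocks}\}$. $\sigma_\tau$ is obtained by dropping timing instructions; $\tau$ is valid if $\sigma_\tau$ is; then $G_\tau$ is $G_{\sigma_\tau}$ with node $i$ relabeled by $\tau_i$. Weighted graph $\mathcal{G}_\tau$. $\Gamma_M=\{\mathsf{succ}\}\cup(\{<,\le\}\times\{ -(M-1),\dots,M-1\})$. For a position $i$ let $p_x(i)$ be the largest $j<i$ with $(x:=0)\in\tau_j$, and $p_d(i)$ the $j$ (if any) with a $d$-edge $j\to i$ in $G_\tau$. $\mathcal{G}_\tau$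 is the $(\emptyset,\Gamma_M)$-graph with vertices $\{1,\dots,n\}$, $\mathsf{succ}$-edges $i\to i+1$, and exactly the following weighted edges: for each position $i$ and each constraint in $\tau_i$, put $(s,t)=(p_a(i),i)$ if the constraint is $a\bowtie\beta$ with $a\in\mathsf{Clocks}\cup\mathsf{DS}$, and $(s,t)=(p_a(i),p_b(i))$ if it is $(a-b)\bowtie\beta$ (when these positions exist); add $(s,\bowtie,\beta,t)$ if $\bowtie\in\{<,\le\}$; add $(t,<,-\beta,s)$ if $\bowtie$ is $>$; add $(t,\le,-\beta,s)$ if $\bowtie$ is $\ge$; add both $(s,\le,\beta,t)$ and $(t,\le,-\beta,s)$ if $\bowtie$ is $=$. -}

module Defs where

open import Data.Empty using (⊥)
open import Data.Fin.Base using (Fin; zero; suc; toℕ; fromℕ<)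
import Data.Fin.Base as Fin
open import Data.Fin.Properties using (toℕ<n; toℕ-fromℕ<; <-cmp)
import Data.Fin.Properties as Fin
open import Data.Integer.Base using (ℤ; +_; -_; ∣_∣)
open import Data.Integer.Properties using (∣-i∣≡∣i∣)
open import Data.List.Base using (List; []; _∷_; filter; length; tabulate; take)
open import Data.List.Properties
  using (filter-++; filter-accept; filter-reject; length-++; length-tabulate; take-all; take-suc-tabulate)
open import Data.Nat.Base using (ℕ; zero; suc; _+_; _∸_; _≤_; _<_; z≤n; s≤s)
open import Data.Nat.Properties
  using (≤-refl; ≤-trans; ≤-reflexive; ≤-antisym; ≤-pred; <⇒≤; <⇒≱; ≮⇒≥; <-trans; <-irrefl; _<?_;
         n≤1+n; m≤n⇒m≤1+n; m≤n⇒m<n∨m≡n; m≤m+n; n∸n≡0; m+[n∸m]≡n; +-∸-assoc; +-comm; +-identityʳ; +-suc)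
open import Data.Product using (∃!; ∃-syntax; _×_; _,_; proj₁; proj₂)
open import Data.Sum.Base using (_⊎_; inj₁; inj₂)
open import Function.Base using (flip)
open import Function.Bundles using (_⇔_)
open import Level using (0ℓ)
open import Relation.Binary.Construct.Closure.ReflexiveTransitive using (Star)
import Relation.Binary.Construct.Union as Rel
open import Relation.Binary.Core using (Rel)
open import Relation.Binary.Definitions using (DecidableEquality; tri<; tri≈; tri>)
open import Relation.Binary.PropositionalEquality
  using (_≡_; _≢_; refl; sym; trans; cong; cong₂; subst; subst₂)
open import Relation.Nullary.Decidable.Core using (yes; no; map′)
open import Relation.Nullary.Negation.Core using (¬_; contradiction)
open import Relation.Unary using (Pred; _∈_; _∉_; _≐_; _∪_; ∁; U)

------------------------------------------------------------------------
-- Labeled graphs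

record LabeledGraph (Σ Γ : Set) (n : ℕ) : Set₁ where
  field
    label : Fin n → Pred Σ 0ℓ
    edge  : Γ → Rel (Fin n) 0ℓ

open LabeledGraph public

------------------------------------------------------------------------
-- CPDL

mutual
  data StateFormula (Σ Γ : Set) : Set where
    true  : StateFormula Σ Γ
    atom  : Σ → StateFormula Σ Γ
    _or_  : StateFormula Σ Γ → StateFormula Σ Γ → StateFormula Σ Γ
    not   : StateFormula Σ Γ → StateFormula Σ Γ
    ⟨_⟩_  : PathFormula Σ Γ → StateFormula Σ Γ → StateFormula Σ Γ

  data PathFormula (Σ Γ : Set) : Set where
    step  : Γ → PathFormula Σ Γ
    test  : StateFormula Σ Γ → PathFormula Σ Γ
    _⊕_   : PathFormula Σ Γ → PathFormula Σ Γ → PathFormula Σ Γ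
    _·_   : PathFormula Σ Γ → PathFormula Σ Γ → PathFormula Σ Γ
    _*    : PathFormula Σ Γ → PathFormula Σ Γ
    _⁻¹   : PathFormula Σ Γ → PathFormula Σ Γ

module _ {Σ Γ : Set} {n : ℕ} (G : LabeledGraph Σ Γ n) where

  mutual
    ⟦_⟧ˢ : StateFormula Σ Γ → Pred (Fin n) 0ℓ
    ⟦ true ⟧ˢ       = U
    ⟦ atom p ⟧ˢ     = λ v → p ∈ label G v
    ⟦ φ or ψ ⟧ˢ     = ⟦ φ ⟧ˢ ∪ ⟦ ψ ⟧ˢ
    ⟦ not φ ⟧ˢ      = ∁ ⟦ φ ⟧ˢ
    ⟦ ⟨ π ⟩ φ ⟧ˢ    = λ u → ∃[ v ] v ∈ ⟦ φ ⟧ˢ × ⟦ π ⟧ᵖ u v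

    ⟦_⟧ᵖ : PathFormula Σ Γ → Rel (Fin n) 0ℓ
    ⟦ step γ ⟧ᵖ     = edge G γ
    ⟦ test φ ⟧ᵖ     = λ u v → u ≡ v × v ∈ ⟦ φ ⟧ˢ
    ⟦ π ⊕ ρ ⟧ᵖ      = ⟦ π ⟧ᵖ Rel.∪ ⟦ ρ ⟧ᵖ
    ⟦ π · ρ ⟧ᵖ      = λ u v → ∃[ t ] ⟦ π ⟧ᵖ u t × ⟦ ρ ⟧ᵖ t v
    ⟦ π * ⟧ᵖ        = Star ⟦ π ⟧ᵖ
    ⟦ π ⁻¹ ⟧ᵖ       = flip ⟦ π ⟧ᵖ

infix 4 _,_⊨ˢ_ _,_,_⊨ᵖ_

_,_⊨ˢ_ : ∀ {Σ Γ n} → LabeledGraph Σ Γ n → Fin n → StateFormula Σ Γ → Set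
G , u ⊨ˢ φ = u ∈ ⟦ G ⟧ˢ φ

_,_,_⊨ᵖ_ : ∀ {Σ Γ n} → LabeledGraph Σ Γ n → Fin n → Fin n → PathFormula Σ Γ → Set
G , u , v ⊨ᵖ π = ⟦ G ⟧ᵖ π u v

record Interpretation (Σ Γ Σ′ Γ′ : Set) : Set where
  field
    stateFormula : Σ′ → StateFormula Σ Γ
    pathFormula  : Γ′ → PathFormula Σ Γ

open Interpretation public

infix 4 _≗_⟪_⟫

-- G′ ≗ I ⟪ G ⟫ is the relation written G′ = I(G). For families of graphs, I is to
-- be chosen uniformly: on a single graph with a succ-path through all vertices,
-- formulas can name each vertex by its position and so interpret anything.
_≗_⟪_⟫ : ∀ {Σ Γ Σ′ Γ′ n} →
         LabeledGraph Σ′ Γ′ n → Interpretation Σ Γ Σ′ Γ′ → LabeledGraph Σ Γ n → Set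
G′ ≗ I ⟪ G ⟫ =
  (∀ u p → p ∈ label G′ u ⇔ G , u ⊨ˢ stateFormula I p) ×
  (∀ u γ v → edge G′ γ u v ⇔ G , u , v ⊨ᵖ pathFormula I γ)

------------------------------------------------------------------------
-- Data structures, and the matching of writes with reads
--
-- Throughout, K is the number of data structures and C the number of clocks.

data Kind : Set where
  stack queue : Kind

data DSLetter (K : ℕ) : Set where
  r w : Fin K → DSLetter K
  nop : DSLetter K

data DSEdge (K : ℕ) : Set where
  succ : DSEdge K
  ds   : Fin K → DSEdge K

Succ : ∀ {n} → Rel (Fin n) 0ℓ
Succ i j = toℕ j ≡ suc (toℕ i)

Discipline : ∀ {n} → Kind → Rel (Fin n) 0ℓ → Set
Discipline stack R = ∀ {i j i′ j′} → R i j → R i′ j′ → i Fin.< i′ → i′ Fin.< j → j′ Fin.< j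
Discipline queue R = ∀ {i j i′ j′} → R i j → R i′ j′ → i Fin.< i′ → j Fin.< j′

module _ {K : ℕ} where

  r-injective : ∀ {d e : Fin K} → r d ≡ r e → d ≡ e
  r-injective refl = refl

  w-injective : ∀ {d e : Fin K} → w d ≡ w e → d ≡ e
  w-injective refl = refl

  _≟_ : DecidableEquality (DSLetter K)
  r d ≟ r e = map′ (cong r) r-injective (d Fin.≟ e)
  r _ ≟ w _ = no λ ()
  r _ ≟ nop = no λ ()
  w _ ≟ r _ = no λ ()
  w d ≟ w e = map′ (cong w) w-injective (d Fin.≟ e)
  w _ ≟ nop = no λ ()
  nop ≟ r _ = no λ ()
  nop ≟ w _ = no λ ()
  nop ≟ nop = yes refl

  occurrences : DSLetter K → List (DSLetter K) → ℕ
  occurrences a σ = length (filter (_≟ a) σ)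

  prefix : ∀ {n} → ℕ → (Fin n → DSLetter K) → List (DSLetter K)
  prefix k σ = take k (tabulate σ)

  Valid : ∀ {n} → (Fin n → DSLetter K) → Set
  Valid σ = ∀ d →
    (∀ k → occurrences (r d) (prefix k σ) ≤ occurrences (w d) (prefix k σ)) ×
    occurrences (r d) (tabulate σ) ≡ occurrences (w d) (tabulate σ)

  record IsMatching {n} (κ : Kind) (σ : Fin n → DSLetter K) (d : Fin K)
                    (R : Rel (Fin n) 0ℓ) : Set where
    field
      source     : ∀ {i j} → R i j → σ i ≡ w d
      target     : ∀ {i j} → R i j → σ j ≡ r d
      later      : ∀ {i j} → R i j → i Fin.< j
      read-of    : ∀ i → σ i ≡ w d → ∃! _≡_ λ j → R i j
      write-of   : ∀ j → σ j ≡ r d → ∃! _≡_ λ i → R i j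
      discipline : Discipline κ R

  -- The d-edges of G_σ, for all d. For valid σ they exist (see `matching` below) and are
  -- unique, so to quantify over matchings is to speak of G_σ itself.
  record Matching (kind : Fin K → Kind) {n} (σ : Fin n → DSLetter K) : Set₁ where
    field
      match      : Fin K → Rel (Fin n) 0ℓ
      isMatching : ∀ d → IsMatching (kind d) σ d (match d)

  open Matching public

private
  -- The last ascent of f through the level v before b.
  ascent : (f : ℕ → ℕ) (v b : ℕ) → (∀ k → k < b → f (suc k) ≤ suc (f k)) →
           f 0 ≤ v → v < f b →
           ∃[ k ] k < b × f k ≡ v × f (suc k) ≡ suc v × (∀ m → k < m → m ≤ b → v < f m)
  ascent f v zero    up f0≤v v<f0 = contradiction f0≤v (<⇒≱ v<f0)
  ascent f v (suc b) up f0≤v v<fb with v <? f b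
  ... | no v≮fb = b , ≤-refl , fb≡v ,
                  ≤-antisym (subst (λ z → f (suc b) ≤ suc z) fb≡v (up b ≤-refl)) v<fb ,
                  λ m b<m m≤b → subst (λ z → v < f z) (≤-antisym b<m m≤b) v<fb
    where
    fb≡v : f b ≡ v
    fb≡v = ≤-antisym (≮⇒≥ v≮fb) (≤-pred (≤-trans v<fb (up b ≤-refl)))
  ... | yes v<f with ascent f v b (λ k k<b → up k (m≤n⇒m≤1+n k<b)) f0≤v v<f
  ...   | k , k<b , fk≡v , fk+1≡ , above = k , m≤n⇒m≤1+n k<b , fk≡v , fk+1≡ , above′
    where
    above′ : ∀ m → k < m → m ≤ suc b → v < f m
    above′ m k<m m≤b with m≤n⇒m<n∨m≡n m≤b
    ... | inj₁ m<b  = above m k<m (≤-pred m<b)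
    ... | inj₂ refl = v<fb

  -- The first descent of f to the level v after a.
  descent : (f : ℕ → ℕ) (v a t : ℕ) → (∀ k → k < a + t → f k ≤ suc (f (suc k))) →
            v < f a → f (a + t) ≤ v →
            ∃[ k ] a ≤ k × k < a + t × f k ≡ suc v × f (suc k) ≡ v ×
                   (∀ m → a ≤ m → m ≤ k → v < f m)
  descent f v a zero down v<fa end =
    contradiction (subst (λ z → f z ≤ v) (+-identityʳ a) end) (<⇒≱ v<fa)
  descent f v a (suc t) down v<fa end with v <? f (suc a)
  ... | no v≮f = a , ≤-refl , a<a+t ,
                 ≤-antisym (≤-trans (down a a<a+t) (s≤s (≮⇒≥ v≮f))) v<fa ,
                 ≤-antisym (≮⇒≥ v≮f) (≤-pred (≤-trans v<fa (down a a<a+t))) ,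
                 λ m a≤m m≤a → subst (λ z → v < f z) (≤-antisym a≤m m≤a) v<fa
    where
    a<a+t : a < a + suc t
    a<a+t = subst (a <_) (sym (+-suc a t)) (s≤s (m≤m+n a t))
  ... | yes v<f with descent f v (suc a) t
                       (λ k k<  → down k (subst (k <_) (sym (+-suc a t)) k<))
                       v<f (subst (λ z → f z ≤ v) (+-suc a t) end)
  ...   | k , a<k , k< , fk≡ , fk+1≡ , above =
          k , <⇒≤ a<k , subst (k <_) (sym (+-suc a t)) k< , fk≡ , fk+1≡ , above′
    where
    above′ : ∀ m → a ≤ m → m ≤ k → v < f m
    above′ m a≤m m≤k with m≤n⇒m<n∨m≡n a≤m
    ... | inj₁ a<m  = above m a<m m≤k
    ... | inj₂ refl = v<fa

  module Existence {K n : ℕ} (σ : Fin n → DSLetter K) (d : Fin K)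
                   (valid : (∀ k → occurrences (r d) (prefix k σ) ≤ occurrences (w d) (prefix k σ)) ×
                            occurrences (r d) (tabulate σ) ≡ occurrences (w d) (tabulate σ)) where

    count : DSLetter K → ℕ → ℕ
    count a k = occurrences a (prefix k σ)

    R W H : ℕ → ℕ
    R = count (r d)
    W = count (w d)
    H k = W k ∸ R k

    count-step : ∀ a i → count a (suc (toℕ i)) ≡ count a (toℕ i) + occurrences a (σ i ∷ [])
    count-step a i =
      trans (cong (occurrences a) (take-suc-tabulate σ i))
            (trans (cong length (filter-++ (_≟ a) (prefix (toℕ i) σ) (σ i ∷ [])))
                   (length-++ (filter (_≟ a) (prefix (toℕ i) σ))))

    hit : ∀ {a} i → σ i ≡ a → count a (suc (toℕ i)) ≡ suc (count a (toℕ i))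
    hit {a} i σi≡a =
      trans (count-step a i)
            (trans (cong (λ l → count a (toℕ i) + length l) (filter-accept (_≟ a) σi≡a)) (+-comm _ 1))

    miss : ∀ {a} i → σ i ≢ a → count a (suc (toℕ i)) ≡ count a (toℕ i)
    miss {a} i σi≢a =
      trans (count-step a i)
            (trans (cong (λ l → count a (toℕ i) + length l) (filter-reject (_≟ a) σi≢a)) (+-identityʳ _))

    r≢w : ∀ {a} → a ≡ r d → a ≢ w d
    r≢w refl ()

    w≢r : ∀ {a} → a ≡ w d → a ≢ r d
    w≢r refl ()

    H-write : ∀ i → σ i ≡ w d → H (suc (toℕ i)) ≡ suc (H (toℕ i))
    H-write i p = trans (cong₂ _∸_ (hit i p) (miss i (w≢r p)))
                        (+-∸-assoc 1 (proj₁ valid (toℕ i)))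

    H-read : ∀ j → σ j ≡ r d → H (toℕ j) ≡ suc (H (suc (toℕ j)))
    H-read j q = trans (cong₂ (λ x y → suc x ∸ y) (sym (miss j (r≢w q))) (sym (hit j q)))
                       (+-∸-assoc 1 (proj₁ valid (suc (toℕ j))))

    H-other : ∀ i → σ i ≢ w d → σ i ≢ r d → H (suc (toℕ i)) ≡ H (toℕ i)
    H-other i ¬p ¬q = cong₂ _∸_ (miss i ¬p) (miss i ¬q)

    at-index : (P : ℕ → Set) → (∀ i → P (toℕ i)) → ∀ k → k < n → P k
    at-index P p k k<n = subst P (toℕ-fromℕ< k<n) (p (fromℕ< k<n))

    count-up : ∀ a k → k < n → count a (suc k) ≤ suc (count a k)
    count-up a = at-index (λ k → count a (suc k) ≤ suc (count a k)) up
      where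
      up : ∀ i → count a (suc (toℕ i)) ≤ suc (count a (toℕ i))
      up i with σ i ≟ a
      ... | yes p = ≤-reflexive (hit i p)
      ... | no ¬p = m≤n⇒m≤1+n (≤-reflexive (miss i ¬p))

    H-up : ∀ k → k < n → H (suc k) ≤ suc (H k)
    H-up = at-index (λ k → H (suc k) ≤ suc (H k)) up
      where
      up : ∀ i → H (suc (toℕ i)) ≤ suc (H (toℕ i))
      up i with σ i ≟ w d | σ i ≟ r d
      ... | yes p | _     = ≤-reflexive (H-write i p)
      ... | no ¬p | yes q = ≤-trans (n≤1+n _) (≤-trans (≤-reflexive (sym (H-read i q))) (n≤1+n _))
      ... | no ¬p | no ¬q = m≤n⇒m≤1+n (≤-reflexive (H-other i ¬p ¬q))

    H-down : ∀ k → k < n → H k ≤ suc (H (suc k))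
    H-down = at-index (λ k → H k ≤ suc (H (suc k))) down
      where
      down : ∀ i → H (toℕ i) ≤ suc (H (suc (toℕ i)))
      down i with σ i ≟ w d | σ i ≟ r d
      ... | yes p | _     = ≤-trans (n≤1+n _) (≤-trans (≤-reflexive (sym (H-write i p))) (n≤1+n _))
      ... | no ¬p | yes q = ≤-reflexive (H-read i q)
      ... | no ¬p | no ¬q = m≤n⇒m≤1+n (≤-reflexive (sym (H-other i ¬p ¬q)))

    count-mono : ∀ a k l → k ≤ l → l ≤ n → count a k ≤ count a l
    count-mono a zero zero    z≤n l≤n = ≤-refl
    count-mono a k    (suc l) k≤l l≤n with m≤n⇒m<n∨m≡n k≤l
    ... | inj₂ refl = ≤-refl
    ... | inj₁ k<l  = ≤-trans (count-mono a k l (≤-pred k<l) (<⇒≤ l≤n))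
                              (at-index (λ k → count a k ≤ count a (suc k)) grow l l≤n)
      where
      grow : ∀ i → count a (toℕ i) ≤ count a (suc (toℕ i))
      grow i with σ i ≟ a
      ... | yes p = ≤-trans (n≤1+n _) (≤-reflexive (sym (hit i p)))
      ... | no ¬p = ≤-reflexive (sym (miss i ¬p))

    R≡W : R n ≡ W n
    R≡W = subst (λ l → occurrences (r d) l ≡ occurrences (w d) l)
                (sym (take-all n (tabulate σ) (≤-reflexive (length-tabulate σ)))) (proj₂ valid)

    H-end : H n ≡ 0
    H-end = trans (cong (W n ∸_) R≡W) (n∸n≡0 (W n))

    letter-at : ∀ {a} k (k<n : k < n) → count a k < count a (suc k) → σ (fromℕ< k<n) ≡ a
    letter-at {a} k k<n grows with σ (fromℕ< k<n) ≟ a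
    ... | yes p = p
    ... | no ¬p = contradiction grows
      (<-irrefl (sym (subst (λ l → count a (suc l) ≡ count a l) (toℕ-fromℕ< k<n) (miss (fromℕ< k<n) ¬p))))

    H-grows⇒write : ∀ i → H (toℕ i) < H (suc (toℕ i)) → σ i ≡ w d
    H-grows⇒write i grows with σ i ≟ w d | σ i ≟ r d
    ... | yes p | _     = p
    ... | no ¬p | yes q = contradiction (<-trans grows (≤-reflexive (sym (H-read i q)))) (<-irrefl refl)
    ... | no ¬p | no ¬q = contradiction grows (<-irrefl (sym (H-other i ¬p ¬q)))

    H-drops⇒read : ∀ i → H (suc (toℕ i)) < H (toℕ i) → σ i ≡ r d
    H-drops⇒read i drops with σ i ≟ w d | σ i ≟ r d
    ... | _     | yes q = q
    ... | yes p | no _  = contradiction (<-trans drops (≤-reflexive (sym (H-write i p)))) (<-irrefl refl)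
    ... | no ¬p | no ¬q = contradiction drops (<-irrefl (H-other i ¬p ¬q))

    strict : ∀ {a} {i j : Fin n} → σ i ≡ a → i Fin.< j → count a (toℕ i) < count a (toℕ j)
    strict {i = i} {j} p i<j =
      ≤-trans (≤-reflexive (sym (hit i p))) (count-mono _ _ _ i<j (<⇒≤ (toℕ<n j)))

    same : ∀ {a} {i j : Fin n} → σ i ≡ a → σ j ≡ a → count a (toℕ i) ≡ count a (toℕ j) → i ≡ j
    same {i = i} {j} p q eq with <-cmp i j
    ... | tri< i<j _ _ = contradiction (strict p i<j) (<-irrefl eq)
    ... | tri≈ _ i≡j _ = i≡j
    ... | tri> _ _ j<i = contradiction (strict q j<i) (<-irrefl (sym eq))

    Fifo : Rel (Fin n) 0ℓ
    Fifo i j = σ i ≡ w d × σ j ≡ r d × W (toℕ i) ≡ R (toℕ j)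

    fifo : IsMatching queue σ d Fifo
    fifo = record
      { source     = proj₁
      ; target     = λ e → proj₁ (proj₂ e)
      ; later      = later
      ; read-of    = read-of
      ; write-of   = write-of
      ; discipline = λ (p , _ , e) (_ , _ , e′) i<i′ → order (subst₂ _<_ e e′ (strict p i<i′))
      }
      where
      order : ∀ {i j : Fin n} → R (toℕ i) < R (toℕ j) → i Fin.< j
      order {i} {j} Ri<Rj with toℕ i <? toℕ j
      ... | yes i<j = i<j
      ... | no i≮j  = contradiction (count-mono (r d) _ _ (≮⇒≥ i≮j) (<⇒≤ (toℕ<n i))) (<⇒≱ Ri<Rj)

      later : ∀ {i j} → Fifo i j → i Fin.< j
      later {i} {j} (p , q , e) with toℕ i <? toℕ j
      ... | yes i<j = i<j
      ... | no i≮j  = contradiction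
        (≤-trans (≤-trans (≤-reflexive (sym (hit j q))) (proj₁ valid (suc (toℕ j))))
                 (≤-trans (≤-reflexive (miss j (r≢w q)))
                          (≤-trans (count-mono (w d) _ _ (≮⇒≥ i≮j) (<⇒≤ (toℕ<n i))) (≤-reflexive e))))
        (<-irrefl refl)

      read-of : ∀ i → σ i ≡ w d → ∃! _≡_ (Fifo i)
      read-of i p with ascent R (W (toℕ i)) n (count-up (r d)) z≤n
        (subst (W (toℕ i) <_) (sym R≡W)
          (≤-trans (≤-reflexive (sym (hit i p))) (count-mono (w d) _ _ (toℕ<n i) ≤-refl)))
      ... | k , k<n , Rk , Rk+1 , _ =
        fromℕ< k<n , (p , q , e) , λ (_ , q′ , e′) → same q q′ (trans (sym e) e′)
        where
        q : σ (fromℕ< k<n) ≡ r d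
        q = letter-at k k<n (subst₂ _<_ (sym Rk) (sym Rk+1) ≤-refl)

        e : W (toℕ i) ≡ R (toℕ (fromℕ< k<n))
        e = trans (sym Rk) (cong R (sym (toℕ-fromℕ< k<n)))

      write-of : ∀ j → σ j ≡ r d → ∃! _≡_ (λ i → Fifo i j)
      write-of j q with ascent W (R (toℕ j)) n (count-up (w d)) z≤n
        (subst (R (toℕ j) <_) R≡W
          (≤-trans (≤-reflexive (sym (hit j q))) (count-mono (r d) _ _ (toℕ<n j) ≤-refl)))
      ... | k , k<n , Wk , Wk+1 , _ =
        fromℕ< k<n , (p , q , e) , λ (p′ , _ , e′) → same p p′ (trans e (sym e′))
        where
        p : σ (fromℕ< k<n) ≡ w d
        p = letter-at k k<n (subst₂ _<_ (sym Wk) (sym Wk+1) ≤-refl)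

        e : W (toℕ (fromℕ< k<n)) ≡ R (toℕ j)
        e = trans (cong W (toℕ-fromℕ< k<n)) Wk

    Lifo : Rel (Fin n) 0ℓ
    Lifo i j = σ i ≡ w d × σ j ≡ r d × i Fin.< j × H (toℕ i) ≡ H (suc (toℕ j)) ×
               (∀ m → toℕ i < m → m ≤ toℕ j → H (toℕ i) < H m)

    lifo : IsMatching stack σ d Lifo
    lifo = record
      { source     = proj₁
      ; target     = λ e → proj₁ (proj₂ e)
      ; later      = λ e → proj₁ (proj₂ (proj₂ e))
      ; read-of    = read-of
      ; write-of   = write-of
      ; discipline = nested
      }
      where
      no-earlier-read : ∀ {i j j′} → Lifo i j → Lifo i j′ → ¬ (j Fin.< j′)
      no-earlier-read (_ , _ , i<j , e , _) (_ , _ , _ , _ , above) j<j′ =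
        <-irrefl e (above _ (m≤n⇒m≤1+n i<j) j<j′)

      no-later-write : ∀ {i i′ j} → Lifo i j → Lifo i′ j → ¬ (i Fin.< i′)
      no-later-write (_ , _ , _ , e , above) (_ , _ , i′<j , e′ , _) i<i′ =
        <-irrefl (trans e (sym e′)) (above _ i<i′ (<⇒≤ i′<j))

      unique-read : ∀ {i j j′} → Lifo i j → Lifo i j′ → j ≡ j′
      unique-read {j = j} {j′} e e′ with <-cmp j j′
      ... | tri< j<j′ _ _ = contradiction j<j′ (no-earlier-read e e′)
      ... | tri≈ _ j≡j′ _ = j≡j′
      ... | tri> _ _ j′<j = contradiction j′<j (no-earlier-read e′ e)

      unique-write : ∀ {i i′ j} → Lifo i j → Lifo i′ j → i ≡ i′
      unique-write {i} {i′} e e′ with <-cmp i i′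
      ... | tri< i<i′ _ _ = contradiction i<i′ (no-later-write e e′)
      ... | tri≈ _ i≡i′ _ = i≡i′
      ... | tri> _ _ i′<i = contradiction i′<i (no-later-write e′ e)

      nested : Discipline stack Lifo
      nested {i} {j} {i′} {j′} x@(_ , _ , i<j , e , above) y@(_ , _ , i′<j′ , e′ , above′) i<i′ i′<j
        with <-cmp j′ j
      ... | tri< j′<j _ _ = j′<j
      ... | tri≈ _ refl _ = contradiction i<i′ (no-later-write x y)
      ... | tri> _ _ j<j′ = contradiction
        (<-trans (above _ i<i′ (<⇒≤ i′<j)) (above′ _ (m≤n⇒m≤1+n i′<j) j<j′))
        (<-irrefl e)

      read-of : ∀ i → σ i ≡ w d → ∃! _≡_ (Lifo i)
      read-of i p with descent H (H (toℕ i)) (suc (toℕ i)) (n ∸ suc (toℕ i))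
        (λ k k< → H-down k (subst (k <_) (m+[n∸m]≡n (toℕ<n i)) k<))
        (≤-reflexive (sym (H-write i p)))
        (subst (λ z → H z ≤ H (toℕ i)) (sym (m+[n∸m]≡n (toℕ<n i)))
               (subst (_≤ H (toℕ i)) (sym H-end) z≤n))
      ... | k , i<k , k< , Hk , Hk+1 , above
        with k<n ← subst (k <_) (m+[n∸m]≡n (toℕ<n i)) k<
        with fromℕ< k<n | toℕ-fromℕ< k<n
      ... | j | refl = j , edge-ij , unique-read edge-ij
        where
        edge-ij : Lifo i j
        edge-ij = p , H-drops⇒read j (subst₂ _<_ (sym Hk+1) (sym Hk) ≤-refl) , i<k , sym Hk+1 , above

      write-of : ∀ j → σ j ≡ r d → ∃! _≡_ (λ i → Lifo i j)
      write-of j q with ascent H (H (suc (toℕ j))) (toℕ j)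
        (λ k k<j → H-up k (<-trans k<j (toℕ<n j))) z≤n (≤-reflexive (sym (H-read j q)))
      ... | k , k<j , Hk , Hk+1 , above
        with k<n ← <-trans k<j (toℕ<n j)
        with fromℕ< k<n | toℕ-fromℕ< k<n
      ... | i | refl = i , edge-ij , λ e → unique-write edge-ij e
        where
        edge-ij : Lifo i j
        edge-ij = H-grows⇒write i (subst₂ _<_ (sym Hk) (sym Hk+1) ≤-refl) , q , k<j , Hk ,
                  λ m i<m m≤j → subst (_< H m) (sym Hk) (above m i<m m≤j)

matching : ∀ {K n} (kind : Fin K → Kind) (σ : Fin n → DSLetter K) → Valid σ → Matching kind σ
matching {n = n} kind σ valid = record
  { match      = λ d → relation (kind d) d
  ; isMatching = λ d → proof (kind d) d
  }
  where
  relation : Kind → ∀ d → Rel (Fin n) 0ℓ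
  relation stack d = Existence.Lifo σ d (valid d)
  relation queue d = Existence.Fifo σ d (valid d)

  proof : ∀ κ d → IsMatching κ σ d (relation κ d)
  proof stack d = Existence.lifo σ d (valid d)
  proof queue d = Existence.fifo σ d (valid d)

------------------------------------------------------------------------
-- Timed instructions

data Comparison : Set where
  le lt eq gt ge : Comparison

-- The two-argument constructors stand for the difference first − second.
data Quantity (K C : ℕ) : Set where
  clk     : (x : Fin C) → Quantity K C
  dat     : (d : Fin K) → Quantity K C
  clk-clk : (x y : Fin C) → Quantity K C
  dat-clk : (d : Fin K) (x : Fin C) → Quantity K C
  clk-dat : (x : Fin C) (d : Fin K) → Quantity K C

data Letter (K C M : ℕ) : Set where
  instr      : DSLetter K → Letter K C M
  reset      : Fin C → Letter K C M
  constraint : Quantity K C → Comparison → Fin M → Letter K C M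

-- Sequences of length suc n: the first letter τ₁ is always present.
record Instructions (K C M n : ℕ) : Set₁ where
  field
    letters : Fin (suc n) → Pred (Letter K C M) 0ℓ
    one-ds  : ∀ i → ∃! _≡_ λ a → instr a ∈ letters i
    initial : letters zero ≐ λ a → a ≡ instr nop ⊎ (∃[ x ] a ≡ reset x)

  untimed : Fin (suc n) → DSLetter K
  untimed i = proj₁ (one-ds i)

open Instructions public

instructionGraph : ∀ {K C M n} {kind : Fin K → Kind} (τ : Instructions K C M n) →
                   Matching kind (untimed τ) → LabeledGraph (Letter K C M) (DSEdge K) (suc n)
instructionGraph τ m .label         = letters τ
instructionGraph τ m .edge succ     = Succ
instructionGraph τ m .edge (ds d)   = match m d

------------------------------------------------------------------------
-- The weighted graph

-- The integers -(M-1), …, M-1.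
record Weight (M : ℕ) : Set where
  constructor weight
  field
    value  : ℤ
    .bound : ∣ value ∣ < M

pos : ∀ {M} → Fin M → Weight M
pos β = weight (+ toℕ β) (toℕ<n β)

neg : ∀ {M} → Fin M → Weight M
neg {M} β = weight (- (+ toℕ β)) (subst (_< M) (sym (∣-i∣≡∣i∣ (+ toℕ β))) (toℕ<n β))

data Strictness : Set where
  strict weak : Strictness

data WeightedEdge (M : ℕ) : Set where
  succ     : WeightedEdge M
  weighted : Strictness → Weight M → WeightedEdge M

-- Bound s t ⋈ β u ◁ α v : a constraint ⋈ β with endpoints s and t
-- contributes the edge (u , ◁ , α , v).
data Bound {V : Set} {M : ℕ} (s t : V) :
           Comparison → Fin M → V → Strictness → Weight M → V → Set where
  lt  : ∀ {β} → Bound s t lt β s strict (pos β) t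
  le  : ∀ {β} → Bound s t le β s weak   (pos β) t
  gt  : ∀ {β} → Bound s t gt β t strict (neg β) s
  ge  : ∀ {β} → Bound s t ge β t weak   (neg β) s
  eq₁ : ∀ {β} → Bound s t eq β s weak   (pos β) t
  eq₂ : ∀ {β} → Bound s t eq β t weak   (neg β) s

module _ {K C M n : ℕ} {kind : Fin K → Kind}
         (τ : Instructions K C M n) (m : Matching kind (untimed τ)) where

  private
    V : Set
    V = Fin (suc n)

  -- lastReset x i j : p_x(i) exists and equals j.
  lastReset : Fin C → V → V → Set
  lastReset x i j = j Fin.< i × reset x ∈ letters τ j ×
                    (∀ k → j Fin.< k → k Fin.< i → reset x ∉ letters τ k)

  -- writeOf d i j : p_d(i) exists and equals j.
  writeOf : Fin K → V → V → Set
  writeOf d i j = edge (instructionGraph τ m) (ds d) j i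

  Endpoints : V → Quantity K C → V → V → Set
  Endpoints i (clk x)       s t = lastReset x i s × t ≡ i
  Endpoints i (dat d)       s t = writeOf d i s × t ≡ i
  Endpoints i (clk-clk x y) s t = lastReset x i s × lastReset y i t
  Endpoints i (dat-clk d x) s t = writeOf d i s × lastReset x i t
  Endpoints i (clk-dat x d) s t = lastReset x i s × writeOf d i t

  weightedGraph : LabeledGraph ⊥ (WeightedEdge M) (suc n)
  weightedGraph .label _ ()
  weightedGraph .edge succ           = Succ
  weightedGraph .edge (weighted ◁ α) = λ u v →
    ∃[ i ] ∃[ q ] ∃[ ⋈ ] ∃[ β ] constraint q ⋈ β ∈ letters τ i ×
      (∃[ s ] ∃[ t ] Endpoints i q s t × Bound s t ⋈ β u ◁ α v)

{-# OPTIONS --safe #-}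
-- Resets and reads are resolved by walking backwards from the constrained position i:
-- p_d(i) is one converse d-edge away, and p_x(i) is where the walk along converse
-- succ-edges through non-reset positions first meets a reset of x. A constraint at i
-- is thus a path from one endpoint up to i and down to the other. As there are finitely
-- many constraints, the edges of each weight are a finite union of such paths.
module Submission where

open import Defs
open import Data.Fin.Base using (Fin; zero; suc; inject₁)
import Data.Fin.Base as Fin
open import Data.Fin.Induction using (<-weakInduction)
open import Data.Fin.Properties using (toℕ-inject₁; toℕ-injective)
open import Data.Integer.Properties using () renaming (_≟_ to _≟ℤ_)
open import Data.Nat.Base using (ℕ; zero; suc; _≤_; s≤s)
open import Data.Nat.Properties
  using (≤-refl; ≤-reflexive; ≤-trans; ≤-pred; <⇒≱; m≤n⇒m<n∨m≡n; m≤n⇒m≤1+n)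
open import Data.Product using (Σ-syntax; ∃-syntax; _×_; _,_)
open import Data.Sum.Base using (inj₁; inj₂)
open import Data.Empty using (⊥; ⊥-elim)
open import Data.Unit.Base using (tt)
open import Function.Base using (_∘_)
open import Function.Bundles using (_⇔_; mk⇔; Equivalence)
open import Function.Construct.Identity using (⇔-id)
open import Level using (0ℓ)
open import Relation.Binary.Construct.Closure.ReflexiveTransitive using (Star; ε; _◅_)
open import Relation.Binary.Core using (Rel)
open import Relation.Binary.Definitions using (DecidableEquality)
open import Relation.Binary.PropositionalEquality using (_≡_; refl; sym; cong; subst)
open import Relation.Nullary.Decidable.Core using (Dec; yes; no; map′)
open import Relation.Nullary.Negation.Core using (contradiction)
open import Relation.Unary using (Pred; _∈_)

open Equivalence using (to; from)

-- This is the shape to which the denotation of `test φ · (step succ ⁻¹)` unfolds, with `P` the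
-- denotation of `φ`, so facts about it apply to the path formula as they stand.
WalkBack : ∀ {n} → Pred (Fin n) 0ℓ → Rel (Fin n) 0ℓ
WalkBack P u v = ∃[ t ] (u ≡ t × P t) × Succ v t

module _ {n : ℕ} {P : Pred (Fin (suc n)) 0ℓ} where

  private
    -- The interval excludes `j`: a backward step tests the vertex it leaves, so the last vertex of
    -- a walk goes untested.
    Throughout : Rel (Fin (suc n)) 0ℓ
    Throughout t j = j Fin.≤ t × (∀ k → j Fin.< k → k Fin.≤ t → P k)

  walkBack⇒ : ∀ {t j} → Star (WalkBack P) t j → Throughout t j
  walkBack⇒ ε = ≤-refl , λ k j<k k≤j → contradiction k≤j (<⇒≱ j<k)
  walkBack⇒ {t} {j} (_◅_ {j = v} (_ , (refl , Pt) , t≡1+v) walk) with walkBack⇒ walk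
  ... | j≤v , P-above = ≤-trans (m≤n⇒m≤1+n j≤v) (≤-reflexive (sym t≡1+v)) , P-above′
    where
    P-above′ : ∀ k → j Fin.< k → k Fin.≤ t → P k
    P-above′ k j<k k≤t with m≤n⇒m<n∨m≡n k≤t
    -- Either `k` lies at or below `v` and the rest of the walk covers it, or it is `t`, tested by
    -- the first step.
    ... | inj₁ k<t = P-above k j<k (≤-pred (≤-trans k<t (≤-reflexive t≡1+v)))
    ... | inj₂ k≡t = subst P (sym (toℕ-injective k≡t)) Pt

  -- By induction on the start: a walk from `suc t` that does not stop at once moves to `inject₁ t`,
  -- the same position as `t` but in the full vertex set.
  walkBack⇐ : ∀ t {j} → Throughout t j → Star (WalkBack P) t j
  walkBack⇐ = <-weakInduction (λ t → ∀ {j} → Throughout t j → Star (WalkBack P) t j) base extend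
    where
    base : ∀ {j} → Throughout zero j → Star (WalkBack P) zero j
    base {zero} _ = ε

    extend : ∀ t → (∀ {j} → Throughout (inject₁ t) j → Star (WalkBack P) (inject₁ t) j) →
                ∀ {j} → Throughout (suc t) j → Star (WalkBack P) (suc t) j
    extend t walk {j} (j≤1+t , P-above) with m≤n⇒m<n∨m≡n j≤1+t
    ... | inj₂ j≡1+t = subst (Star (WalkBack P) (suc t)) (sym (toℕ-injective j≡1+t)) ε
    ... | inj₁ j<1+t =
      (suc t , (refl , P-above (suc t) j<1+t ≤-refl) , cong suc (sym (toℕ-inject₁ t))) ◅
      walk ( ≤-trans (≤-pred j<1+t) (≤-reflexive (sym (toℕ-inject₁ t)))
           , λ k j<k k≤t → P-above k j<k (m≤n⇒m≤1+n (≤-trans k≤t (≤-reflexive (toℕ-inject₁ t)))))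

module _ {Σ Γ : Set} where

  -- The empty relation, serving as the empty union.
  none : PathFormula Σ Γ
  none = test (not true)

  -- The condition concerns indices of the formula and not vertices, so it is settled while the
  -- formula is being built.
  when : {A : Set} → Dec A → PathFormula Σ Γ → PathFormula Σ Γ
  when (yes _) π = π
  when (no _)  π = none

  ⋃ : ∀ {k} → (Fin k → PathFormula Σ Γ) → PathFormula Σ Γ
  ⋃ {zero}  f = none
  ⋃ {suc k} f = f zero ⊕ ⋃ (f ∘ suc)

  ⋃-quantity : ∀ {K C} → (Quantity K C → PathFormula Σ Γ) → PathFormula Σ Γ
  ⋃-quantity f =
    ⋃ (λ x → f (clk x)) ⊕ (⋃ (λ d → f (dat d)) ⊕ (⋃ (λ x → ⋃ λ y → f (clk-clk x y)) ⊕
    (⋃ (λ d → ⋃ λ x → f (dat-clk d x)) ⊕ ⋃ (λ x → ⋃ λ d → f (clk-dat x d)))))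

  module _ {n : ℕ} (G : LabeledGraph Σ Γ n) {u v : Fin n} where

    when-⇔ : {A : Set} (a? : Dec A) (π : PathFormula Σ Γ) →
             G , u , v ⊨ᵖ when a? π ⇔ (A × G , u , v ⊨ᵖ π)
    when-⇔ (yes a) π = mk⇔ (a ,_) λ (_ , p) → p
    when-⇔ (no ¬a) π = mk⇔ (λ (_ , ¬tt) → ⊥-elim (¬tt tt)) λ (a , _) → contradiction a ¬a

    ⋃⇒ : ∀ {k} {f : Fin k → PathFormula Σ Γ} → G , u , v ⊨ᵖ ⋃ f → ∃[ i ] G , u , v ⊨ᵖ f i
    ⋃⇒ {zero}  (_ , ¬tt) = ⊥-elim (¬tt tt)
    ⋃⇒ {suc k} (inj₁ p)  = zero , p
    ⋃⇒ {suc k} (inj₂ p)  with i , q ← ⋃⇒ p = suc i , q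

    ⋃⇐ : ∀ {k} {f : Fin k → PathFormula Σ Γ} i → G , u , v ⊨ᵖ f i → G , u , v ⊨ᵖ ⋃ f
    ⋃⇐ zero    p = inj₁ p
    ⋃⇐ (suc i) p = inj₂ (⋃⇐ i p)

    ⋃-quantity⇒ : ∀ {K C} {f : Quantity K C → PathFormula Σ Γ} →
                  G , u , v ⊨ᵖ ⋃-quantity f → ∃[ q ] G , u , v ⊨ᵖ f q
    ⋃-quantity⇒ (inj₁ p) with x , p ← ⋃⇒ p = clk x , p
    ⋃-quantity⇒ (inj₂ (inj₁ p)) with d , p ← ⋃⇒ p = dat d , p
    ⋃-quantity⇒ (inj₂ (inj₂ (inj₁ p))) with x , p ← ⋃⇒ p with y , p ← ⋃⇒ p = clk-clk x y , p
    ⋃-quantity⇒ (inj₂ (inj₂ (inj₂ (inj₁ p)))) with d , p ← ⋃⇒ p with x , p ← ⋃⇒ p = dat-clk d x , p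
    ⋃-quantity⇒ (inj₂ (inj₂ (inj₂ (inj₂ p)))) with x , p ← ⋃⇒ p with d , p ← ⋃⇒ p = clk-dat x d , p

    ⋃-quantity⇐ : ∀ {K C} {f : Quantity K C → PathFormula Σ Γ} q →
                  G , u , v ⊨ᵖ f q → G , u , v ⊨ᵖ ⋃-quantity f
    ⋃-quantity⇐ (clk x)       p = inj₁ (⋃⇐ x p)
    ⋃-quantity⇐ (dat d)       p = inj₂ (inj₁ (⋃⇐ d p))
    ⋃-quantity⇐ (clk-clk x y) p = inj₂ (inj₂ (inj₁ (⋃⇐ x (⋃⇐ y p))))
    ⋃-quantity⇐ (dat-clk d x) p = inj₂ (inj₂ (inj₂ (inj₁ (⋃⇐ d (⋃⇐ x p)))))
    ⋃-quantity⇐ (clk-dat x d) p = inj₂ (inj₂ (inj₂ (inj₂ (⋃⇐ x (⋃⇐ d p)))))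

-- The bound is proof-irrelevant, so a weight is determined by its integer.
_≟ʷ_ : ∀ {M} → DecidableEquality (Weight M)
weight a _ ≟ʷ weight b _ = map′ (λ { refl → refl }) (cong Weight.value) (a ≟ℤ b)

module _ {K C M : ℕ} where

  private
    Path : Set
    Path = PathFormula (Letter K C M) (DSEdge K)

  -- The first step back is untested because `p_x(i)` lies strictly before `i`: a reset at `i`
  -- itself must not count. The starred part cannot leave a reset of `x`, so the final test holds
  -- only at the nearest one.
  lastResetPath : Fin C → Path
  lastResetPath x =
    (step succ ⁻¹) · (((test (not (atom (reset x))) · (step succ ⁻¹)) *) · test (atom (reset x)))

  writePath : Fin K → Path
  writePath d = step (ds d) ⁻¹

  sourcePath targetPath : Quantity K C → Path
  sourcePath (clk x)       = lastResetPath x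
  sourcePath (dat d)       = writePath d
  sourcePath (clk-clk x y) = lastResetPath x
  sourcePath (dat-clk d x) = writePath d
  sourcePath (clk-dat x d) = lastResetPath x
  targetPath (clk x)       = test true
  targetPath (dat d)       = test true
  targetPath (clk-clk x y) = lastResetPath y
  targetPath (dat-clk d x) = lastResetPath x
  targetPath (clk-dat x d) = writePath d

  constraintPath : Quantity K C → Comparison → Fin M → Path
  constraintPath q ⋈ β =
    (sourcePath q ⁻¹) · (test (atom (constraint q ⋈ β)) · targetPath q)

  -- These invert `Bound`: they collect the comparisons that yield an edge of the given strictness
  -- from `s` to `t`, or from `t` to `s`. Equality appears in both, always weak.
  forwardPath backwardPath : Strictness → Quantity K C → Fin M → Path
  forwardPath  strict q β = constraintPath q lt β
  forwardPath  weak   q β = constraintPath q le β ⊕ constraintPath q eq β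
  backwardPath strict q β = constraintPath q gt β ⁻¹
  backwardPath weak   q β = (constraintPath q ge β ⊕ constraintPath q eq β) ⁻¹

  -- A union and not a case distinction, since `pos β` and `neg β` coincide when `β` is zero.
  boundPath : Strictness → Weight M → Quantity K C → Fin M → Path
  boundPath ◁ α q β =
    when (α ≟ʷ pos β) (forwardPath ◁ q β) ⊕ when (α ≟ʷ neg β) (backwardPath ◁ q β)

  weightedPath : Strictness → Weight M → Path
  weightedPath ◁ α = ⋃-quantity λ q → ⋃ (boundPath ◁ α q)

  interpretation : Interpretation (Letter K C M) (DSEdge K) ⊥ (WeightedEdge M)
  interpretation .stateFormula ()
  interpretation .pathFormula succ           = step succ
  interpretation .pathFormula (weighted ◁ α) = weightedPath ◁ α

  module _ {n : ℕ} {kind : Fin K → Kind}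
           (τ : Instructions K C M n) (m : Matching kind (untimed τ)) where

    private
      G : LabeledGraph (Letter K C M) (DSEdge K) (suc n)
      G = instructionGraph τ m

    lastReset-⇔ : ∀ x {i j} → lastReset τ m x i j ⇔ G , i , j ⊨ᵖ lastResetPath x
    lastReset-⇔ x = mk⇔ ⇒ ⇐
      where
      ⇒ : ∀ {i j} → lastReset τ m x i j → G , i , j ⊨ᵖ lastResetPath x
      -- A vertex with an earlier reset is not the first, so a step back to `inject₁ i` exists;
      -- `j < suc i` then becomes `j ≤ i`, as the walk requires.
      ⇒ {suc i} {j} (s≤s j≤i , reset-j , none-between) =
        inject₁ i , cong suc (sym (toℕ-inject₁ i)) , j ,
        walkBack⇐ (inject₁ i)
          ( ≤-trans j≤i (≤-reflexive (sym (toℕ-inject₁ i)))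
          , λ k j<k k≤i → none-between k j<k (s≤s (≤-trans k≤i (≤-reflexive (toℕ-inject₁ i))))) ,
        refl , reset-j

      ⇐ : ∀ {i j} → G , i , j ⊨ᵖ lastResetPath x → lastReset τ m x i j
      ⇐ (t , i≡1+t , j , walk , refl , reset-j) with walkBack⇒ walk
      ... | j≤t , none-between =
        ≤-trans (s≤s j≤t) (≤-reflexive (sym i≡1+t)) , reset-j ,
        λ k j<k k<i → none-between k j<k (≤-pred (≤-trans k<i (≤-reflexive i≡1+t)))

    endpoints-⇔ : ∀ q {i s t} →
                  Endpoints τ m i q s t ⇔ (G , i , s ⊨ᵖ sourcePath q × G , i , t ⊨ᵖ targetPath q)
    endpoints-⇔ (clk x) =
      mk⇔ (λ { (e , refl) → to (lastReset-⇔ x) e , refl , tt })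
          (λ { (p , refl , _) → from (lastReset-⇔ x) p , refl })
    endpoints-⇔ (dat d) =
      mk⇔ (λ { (e , refl) → e , refl , tt }) (λ { (p , refl , _) → p , refl })
    endpoints-⇔ (clk-clk x y) =
      mk⇔ (λ (e , f) → to (lastReset-⇔ x) e , to (lastReset-⇔ y) f)
          (λ (p , q) → from (lastReset-⇔ x) p , from (lastReset-⇔ y) q)
    endpoints-⇔ (dat-clk d x) =
      mk⇔ (λ (e , f) → e , to (lastReset-⇔ x) f) (λ (p , q) → p , from (lastReset-⇔ x) q)
    endpoints-⇔ (clk-dat x d) =
      mk⇔ (λ (e , f) → to (lastReset-⇔ x) e , f) (λ (p , q) → from (lastReset-⇔ x) p , q)

    constraint-⇔ : ∀ q ⋈ β {s t} →
                   (∃[ i ] constraint q ⋈ β ∈ letters τ i × Endpoints τ m i q s t) ⇔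
                   G , s , t ⊨ᵖ constraintPath q ⋈ β
    constraint-⇔ q ⋈ β = mk⇔
      (λ (i , c , e) → let p , p′ = to (endpoints-⇔ q) e in i , p , i , (refl , c) , p′)
      (λ { (i , p , _ , (refl , c) , p′) → i , c , from (endpoints-⇔ q) (p , p′) })

    weighted-⇔ : ∀ ◁ α {u v} →
                 edge (weightedGraph τ m) (weighted ◁ α) u v ⇔ G , u , v ⊨ᵖ weightedPath ◁ α
    weighted-⇔ ◁ α {u} {v} = mk⇔ ⇒ ⇐
      where
      Edge : Set
      Edge = edge (weightedGraph τ m) (weighted ◁ α) u v

      include : ∀ q β → G , u , v ⊨ᵖ boundPath ◁ α q β → G , u , v ⊨ᵖ weightedPath ◁ α
      include q β p =
        ⋃-quantity⇐ G {f = λ q → ⋃ (boundPath ◁ α q)} q (⋃⇐ G {f = boundPath ◁ α q} β p)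

      forward : ∀ {q β} → α ≡ pos β → G , u , v ⊨ᵖ forwardPath ◁ q β →
                G , u , v ⊨ᵖ weightedPath ◁ α
      forward {q} {β} e p =
        include q β (inj₁ (from (when-⇔ G (α ≟ʷ pos β) (forwardPath ◁ q β)) (e , p)))

      backward : ∀ {q β} → α ≡ neg β → G , u , v ⊨ᵖ backwardPath ◁ q β →
                 G , u , v ⊨ᵖ weightedPath ◁ α
      backward {q} {β} e p =
        include q β (inj₂ (from (when-⇔ G (α ≟ʷ neg β) (backwardPath ◁ q β)) (e , p)))

      ⇒ : Edge → G , u , v ⊨ᵖ weightedPath ◁ α
      -- The path `p` runs from `s` to `t`. Matching on `b` identifies these with `u` and `v` in one
      -- order or the other, and the converse in `backwardPath` absorbs the swap.
      ⇒ (i , q , ⋈ , β , c , s , t , e , b) with p ← to (constraint-⇔ q ⋈ β) (i , c , e) with b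
      ... | lt  = forward  {q} refl p
      ... | le  = forward  {q} refl (inj₁ p)
      ... | eq₁ = forward  {q} refl (inj₂ p)
      ... | gt  = backward {q} refl p
      ... | ge  = backward {q} refl (inj₁ p)
      ... | eq₂ = backward {q} refl (inj₂ p)

      edge-of : ∀ {q ⋈ β s t} → G , s , t ⊨ᵖ constraintPath q ⋈ β → Bound s t ⋈ β u ◁ α v → Edge
      edge-of {q} {⋈} {β} p b with i , c , e ← from (constraint-⇔ q ⋈ β) p =
        i , q , ⋈ , β , c , _ , _ , e , b

      -- The strictness is already fixed here, so the case split is made on a copy `◁′` tied to it
      -- by an equation.
      forward⁻ : ∀ {q β} ◁′ → ◁ ≡ ◁′ → α ≡ pos β → G , u , v ⊨ᵖ forwardPath ◁′ q β → Edge
      forward⁻ {q} strict refl refl p        = edge-of {q} p lt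
      forward⁻ {q} weak   refl refl (inj₁ p) = edge-of {q} p le
      forward⁻ {q} weak   refl refl (inj₂ p) = edge-of {q} p eq₁

      backward⁻ : ∀ {q β} ◁′ → ◁ ≡ ◁′ → α ≡ neg β → G , u , v ⊨ᵖ backwardPath ◁′ q β → Edge
      backward⁻ {q} strict refl refl p        = edge-of {q} p gt
      backward⁻ {q} weak   refl refl (inj₁ p) = edge-of {q} p ge
      backward⁻ {q} weak   refl refl (inj₂ p) = edge-of {q} p eq₂

      ⇐ : G , u , v ⊨ᵖ weightedPath ◁ α → Edge
      ⇐ p with q , p ← ⋃-quantity⇒ G {f = λ q → ⋃ (boundPath ◁ α q)} p
          with ⋃⇒ G {f = boundPath ◁ α q} p
      ... | β , inj₁ p with e , p ← to (when-⇔ G (α ≟ʷ pos β) (forwardPath ◁ q β)) p =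
        forward⁻ {q} ◁ refl e p
      ... | β , inj₂ p with e , p ← to (when-⇔ G (α ≟ʷ neg β) (backwardPath ◁ q β)) p =
        backward⁻ {q} ◁ refl e p

proposition22 : ∀ (K C M : ℕ) (kind : Fin K → Kind) → 1 ≤ M →
    Σ[ I ∈ Interpretation (Letter K C M) (DSEdge K) ⊥ (WeightedEdge M) ]
    (∀ {n} (τ : Instructions K C M n) → Valid (untimed τ) →
    (m : Matching kind (untimed τ)) →
    weightedGraph τ m ≗ I ⟪ instructionGraph τ m ⟫)
-- The interpretation is chosen before `τ`. There are no labels to interpret, and `succ` has the
-- same edges in both graphs.
proposition22 K C M kind _ = interpretation , λ τ _ m →
  (λ _ ()) , λ where
    u succ           v → ⇔-id _
    u (weighted ◁ α) v → weighted-⇔ τ m ◁ α
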